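{- Let $k\ge1$ and let $g=\bigvee_{i=1}^k T_i$ be a unate DNF formula on $n$ variables in which every term $T_i$ is non-constant. Then, for $x$ uniform in $\{0,1\}^n$, $$\Pr_x\Big[(T_1(x)=1)\wedge\Big(\bigvee_{i=2}^kT_i(x)=0\Big)\Big]\ \le\ \Pr_x\Big[\bigvee_{i=1}^kT_i(x)=0\Big].$$
   Context: A term is an AND of literals, and a DNF formula is an OR of terms. A DNF formula is unate if it does not contain both a variable and its negation (anywhere in the formula). A term is non-constant if it contains at least one literal and does not contain both a variable and its negation. An empty OR is the constant $0$. -}

module Defs where

open import Data.Bool using (Bool; true; false; not)
open import Data.Fin using (Fin)
open import Data.Integer using (+_)
open import Data.List using (List; []; _∷_; _++_; map; length; filter; all; any)
open import Data.List.Membership.Propositional using (_∈_)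
open import Data.List.Relation.Unary.Any using (Any)
open import Data.Nat using (ℕ; zero; suc; _^_)
open import Data.Nat.Properties using (m^n≢0)
open import Data.Product using (_×_)
open import Data.Rational using (ℚ; _/_)
open import Data.Vec as Vec using (Vec; lookup)
open import Level using (0ℓ)
open import Relation.Binary.PropositionalEquality using (_≢_)
open import Relation.Nullary using (¬_)
open import Relation.Unary using (Pred; Decidable)

data Literal (n : ℕ) : Set where
  pos neg : Fin n → Literal n

Term : ℕ → Set
Term n = List (Literal n)

DNF : ℕ → Set
DNF n = List (Term n)

Input : ℕ → Set
Input n = Vec Bool n

evalLiteral : ∀ {n} → Literal n → Input n → Bool
evalLiteral (pos i) x = lookup x i
evalLiteral (neg i) x = not (lookup x i)

evalTerm : ∀ {n} → Term n → Input n → Bool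
evalTerm T x = all (λ l → evalLiteral l x) T

evalDNF : ∀ {n} → DNF n → Input n → Bool
evalDNF g x = any (λ T → evalTerm T x) g

NonConstant : ∀ {n} → Term n → Set
NonConstant T = T ≢ [] × (∀ i → ¬ (pos i ∈ T × neg i ∈ T))

OccursIn : ∀ {n} → Literal n → DNF n → Set
OccursIn l g = Any (l ∈_) g

-- The two occurrences may lie in different terms.
Unate : ∀ {n} → DNF n → Set
Unate g = ∀ i → ¬ (OccursIn (pos i) g × OccursIn (neg i) g)

-- Every element of {0,1}ⁿ is listed exactly once.
cube : ∀ n → List (Input n)
cube zero    = Vec.[] ∷ []
cube (suc n) = map (false Vec.∷_) (cube n) ++ map (true Vec.∷_) (cube n)

Pr : ∀ {n} {P : Pred (Input n) 0ℓ} → Decidable P → ℚ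
Pr {n} P? = (+ length (filter P? (cube n))) / (2 ^ n)
  where instance _ = m^n≢0 2 n

{-# OPTIONS --safe #-}

-- Pick a literal l of T₁ and flip its variable. On inputs x with T₁(x) = 1
-- and all other terms 0, the flip falsifies l, hence T₁; by unateness no term
-- contains the negation of l, so no other term can become true. The flip is
-- an involution of the cube, so the first event is at most as large as the
-- second.
module Submission where

open import Data.Bool using (Bool; true; false; not; _∧_; _∨_; b≤b) renaming (_≤_ to _≤ᵇ_)
open import Data.Bool.ListAction using (all; any)
open import Data.Bool.Properties using (_≟_; ≤-minimum; ≤-maximum; ∧-conicalˡ)
open import Data.Fin as Fin using (Fin; zero; suc)
open import Data.Integer using (+_; +≤+)
import Data.Integer.Properties as ℤ
open import Data.List using ([]; _∷_; map; length; filter)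
open import Data.List.Membership.Propositional using (_∈_; lose)
open import Data.List.Properties using (filter-++; length-++)
open import Data.List.Relation.Binary.Sublist.Propositional using (⊆-refl)
open import Data.List.Relation.Binary.Sublist.Propositional.Properties using (filter⁺; length-mono-≤)
open import Data.List.Relation.Unary.All using (All; _∷_)
open import Data.List.Relation.Unary.Any using (here; there)
open import Data.Nat using (ℕ; suc; _+_; _^_; NonZero) renaming (_≤_ to _≤ⁿ_)
import Data.Nat.Properties as ℕ
open import Data.Product using (_×_; _,_)
open import Data.Rational using (_≤_; _/_)
open import Data.Rational.Properties using (toℚᵘ-cancel-≤; toℚᵘ-fromℚᵘ)
open import Data.Rational.Unnormalised using (mkℚᵘ; *≤*)
import Data.Rational.Unnormalised.Properties as ℚᵘ
open import Data.Vec as Vec using (updateAt)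
open import Data.Vec.Properties using (lookup∘updateAt; lookup∘updateAt′)
open import Function using (_∘_)
open import Level using (0ℓ)
open import Relation.Binary.PropositionalEquality using (_≡_; _≢_; refl; trans; cong; cong₂; subst)
open import Relation.Nullary using (¬_; yes; no; does; contradiction)
open import Relation.Nullary.Decidable using (_×-dec_)
open import Relation.Unary using (Pred; Decidable)
open import Defs

-- `_/_` reduces to lowest terms, so the two sides may end up with different denominators. Passing
-- to unnormalised rationals restores the common denominator, and only the numerators remain to be
-- compared.
/-monoˡ-≤ : ∀ {a b} d .{{_ : NonZero d}} → a ≤ⁿ b → (+ a) / d ≤ (+ b) / d
/-monoˡ-≤ {a} {b} (suc d) a≤b = toℚᵘ-cancel-≤ (begin
  _              ≃⟨ toℚᵘ-fromℚᵘ (mkℚᵘ (+ a) d) ⟩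
  mkℚᵘ (+ a) d   ≤⟨ *≤* (ℤ.*-monoʳ-≤-nonNeg (+ suc d) (+≤+ a≤b)) ⟩
  mkℚᵘ (+ b) d   ≃⟨ toℚᵘ-fromℚᵘ (mkℚᵘ (+ b) d) ⟨
  _              ∎)
  where open ℚᵘ.≤-Reasoning

module _ {A : Set} {P Q : Pred A 0ℓ} (P? : Decidable P) (Q? : Decidable Q) where

  length-filter-mono : (∀ {x} → P x → Q x) → ∀ xs → length (filter P? xs) ≤ⁿ length (filter Q? xs)
  length-filter-mono P⇒Q xs = length-mono-≤ (filter⁺ P? Q? (λ { refl → P⇒Q }) (⊆-refl {x = xs}))

length-filter-map : ∀ {A B : Set} {P : Pred B 0ℓ} (P? : Decidable P) (f : A → B) xs →
                    length (filter P? (map f xs)) ≡ length (filter (P? ∘ f) xs)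
length-filter-map P? f []       = refl
length-filter-map P? f (x ∷ xs) with does (P? (f x))
... | true  = cong suc (length-filter-map P? f xs)
... | false = length-filter-map P? f xs

count : ∀ {n} {P : Pred (Input n) 0ℓ} → Decidable P → ℕ
count {n} P? = length (filter P? (cube n))

count-suc : ∀ {n} {P : Pred (Input (suc n)) 0ℓ} (P? : Decidable P) →
            count P? ≡ count (P? ∘ (false Vec.∷_)) + count (P? ∘ (true Vec.∷_))
count-suc {n} P? =
  trans (cong length (filter-++ P? (map (false Vec.∷_) (cube n)) _))
  (trans (length-++ (filter P? (map (false Vec.∷_) (cube n))))
         (cong₂ _+_ (length-filter-map P? _ (cube n)) (length-filter-map P? _ (cube n))))

flip : ∀ {n} → Fin n → Input n → Input n
flip i x = updateAt x i not

-- Induction on `i` along the recursive structure of `cube` replaces a general argument about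
-- injections: flipping coordinate `zero` exchanges the two halves of the cube, while flipping
-- `suc i` acts inside each half as the flip of `i`.
count-flip-≤ : ∀ {n} (i : Fin n) {P Q : Pred (Input n) 0ℓ} (P? : Decidable P) (Q? : Decidable Q) →
               (∀ x → P x → Q (flip i x)) → count P? ≤ⁿ count Q?
count-flip-≤ {suc n} zero P? Q? P⇒Q = begin
  count P?                                                     ≡⟨ count-suc P? ⟩
  -- `flip zero (false ∷ x)` computes to `true ∷ x` and conversely, so each half for `P` is bounded
  -- by the opposite half for `Q`; commutativity then puts the halves back in order.
  count (P? ∘ (false Vec.∷_)) + count (P? ∘ (true Vec.∷_))     ≤⟨ ℕ.+-mono-≤ (length-filter-mono _ _ (P⇒Q _) (cube n)) (length-filter-mono _ _ (P⇒Q _) (cube n)) ⟩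
  count (Q? ∘ (true Vec.∷_)) + count (Q? ∘ (false Vec.∷_))     ≡⟨ ℕ.+-comm (count (Q? ∘ (true Vec.∷_))) _ ⟩
  count (Q? ∘ (false Vec.∷_)) + count (Q? ∘ (true Vec.∷_))     ≡⟨ count-suc Q? ⟨
  count Q?                                                     ∎
  where open ℕ.≤-Reasoning
count-flip-≤ (suc i) P? Q? P⇒Q = begin
  count P?                                                     ≡⟨ count-suc P? ⟩
  count (P? ∘ (false Vec.∷_)) + count (P? ∘ (true Vec.∷_))     ≤⟨ ℕ.+-mono-≤ (count-flip-≤ i _ _ (λ x → P⇒Q (false Vec.∷ x))) (count-flip-≤ i _ _ (λ x → P⇒Q (true Vec.∷ x))) ⟩
  count (Q? ∘ (false Vec.∷_)) + count (Q? ∘ (true Vec.∷_))     ≡⟨ count-suc Q? ⟨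
  count Q?                                                     ∎
  where open ℕ.≤-Reasoning

∧-mono-≤ : ∀ {a b c d} → a ≤ᵇ b → c ≤ᵇ d → a ∧ c ≤ᵇ b ∧ d
∧-mono-≤ {false} _   _   = ≤-minimum _
∧-mono-≤ {true}  b≤b c≤d = c≤d

∨-mono-≤ : ∀ {a b c d} → a ≤ᵇ b → c ≤ᵇ d → a ∨ c ≤ᵇ b ∨ d
∨-mono-≤ {b = true}  _   _   = ≤-maximum _
∨-mono-≤ {b = false} b≤b c≤d = c≤d

module _ {A : Set} {p q : A → Bool} where

  all-mono-≤ : ∀ xs → (∀ {x} → x ∈ xs → p x ≤ᵇ q x) → all p xs ≤ᵇ all q xs
  all-mono-≤ []       _   = b≤b
  all-mono-≤ (x ∷ xs) p≤q = ∧-mono-≤ (p≤q (here refl)) (all-mono-≤ xs (p≤q ∘ there))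

  any-mono-≤ : ∀ xs → (∀ {x} → x ∈ xs → p x ≤ᵇ q x) → any p xs ≤ᵇ any q xs
  any-mono-≤ []       _   = b≤b
  any-mono-≤ (x ∷ xs) p≤q = ∨-mono-≤ (p≤q (here refl)) (any-mono-≤ xs (p≤q ∘ there))

var : ∀ {n} → Literal n → Fin n
var (pos i) = i
var (neg i) = i

negate : ∀ {n} → Literal n → Literal n
negate (pos i) = neg i
negate (neg i) = pos i

≢negate⇒≡ : ∀ {n} {l m : Literal n} → var m ≡ var l → m ≢ negate l → m ≡ l
≢negate⇒≡ {l = pos i} {pos .i} refl _   = refl
≢negate⇒≡ {l = pos i} {neg .i} refl m≢l = contradiction refl m≢l
≢negate⇒≡ {l = neg i} {pos .i} refl m≢l = contradiction refl m≢l
≢negate⇒≡ {l = neg i} {neg .i} refl _   = refl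

evalLiteral-flip : ∀ {n} (l : Literal n) x → evalLiteral l (flip (var l) x) ≡ not (evalLiteral l x)
evalLiteral-flip (pos i) x = lookup∘updateAt i x
evalLiteral-flip (neg i) x = cong not (lookup∘updateAt i x)

evalLiteral-flip-≢ : ∀ {n} {i : Fin n} (m : Literal n) x → var m ≢ i →
                     evalLiteral m (flip i x) ≡ evalLiteral m x
evalLiteral-flip-≢ (pos j) x j≢i = lookup∘updateAt′ j _ j≢i x
evalLiteral-flip-≢ (neg j) x j≢i = cong not (lookup∘updateAt′ j _ j≢i x)

module _ {n} (l : Literal n) (x : Input n) (lx : evalLiteral l x ≡ true) where

  flip-falsifies : evalLiteral l (flip (var l) x) ≡ false
  flip-falsifies = trans (evalLiteral-flip l x) (cong not lx)

  -- A literal over another variable keeps its value. Over the flipped variable there are only `l`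
  -- and `negate l`; the latter is excluded, and `l` drops to `false`, the least element.
  evalLiteral-flip-≤ : ∀ m → m ≢ negate l → evalLiteral m (flip (var l) x) ≤ᵇ evalLiteral m x
  evalLiteral-flip-≤ m m≢¬l with var m Fin.≟ var l
  ... | no  m≢l rewrite evalLiteral-flip-≢ m x m≢l = b≤b
  ... | yes m≡l rewrite ≢negate⇒≡ {l = l} {m} m≡l m≢¬l | flip-falsifies = ≤-minimum _

  -- AND and OR are monotone, so the bound on single literals lifts through terms to the whole
  -- formula. A literal of `g` equal to `negate l` would be a forbidden occurrence.
  evalDNF-flip-≤ : ∀ g → ¬ OccursIn (negate l) g → evalDNF g (flip (var l) x) ≤ᵇ evalDNF g x
  evalDNF-flip-≤ g ¬l∉g = any-mono-≤ g λ {T} T∈g → all-mono-≤ T λ {m} m∈T →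
    evalLiteral-flip-≤ m λ { refl → ¬l∉g (lose T∈g m∈T) }

unate⇒negate∉ : ∀ {n} {g : DNF n} → Unate g → ∀ l → OccursIn l g → ¬ OccursIn (negate l) g
unate⇒negate∉ u (pos i) l∈g ¬l∈g = u i (l∈g , ¬l∈g)
unate⇒negate∉ u (neg i) l∈g ¬l∈g = u i (¬l∈g , l∈g)

≤false⇒≡false : ∀ {b} → b ≤ᵇ false → b ≡ false
≤false⇒≡false b≤b = refl

lemma2p4 : (n : ℕ) (T₁ : Term n) (Ts : DNF n) → Unate (T₁ ∷ Ts) → All NonConstant (T₁ ∷ Ts) →
    Pr (λ x → (evalTerm T₁ x ≟ true) ×-dec (evalDNF Ts x ≟ false)) ≤ Pr (λ x → evalDNF (T₁ ∷ Ts) x ≟ false)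
-- An empty AND is constantly true and offers no variable to flip; non-constancy of `T₁` rules this
-- case out.
lemma2p4 n []      Ts u ((T₁≢[] , _) ∷ _) = contradiction refl T₁≢[]
-- Both probabilities have denominator `2 ^ n`, so comparing counts suffices; any literal of `T₁`
-- would serve, and the head is taken.
lemma2p4 n (l ∷ T) Ts u _ = /-monoˡ-≤ (2 ^ n) (count-flip-≤ (var l) _ _ falsify)
  where
  instance _ = ℕ.m^n≢0 2 n

  falsify : ∀ x → evalTerm (l ∷ T) x ≡ true × evalDNF Ts x ≡ false →
            evalDNF ((l ∷ T) ∷ Ts) (flip (var l) x) ≡ false
  -- Since `T₁` holds at `x`, so does its head `l`. Rewriting by `flip-falsifies` makes the first
  -- term compute to `false`, which leaves only the claim about `Ts`.
  falsify x (T₁x , Tsx) with lx ← ∧-conicalˡ _ _ T₁x rewrite flip-falsifies l x lx =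
    -- After the flip `Ts` lies below its old value `false`. Unateness of the full formula applies
    -- because `l` occurs in the first term and `there` carries occurrences in `Ts` over to it.
    ≤false⇒≡false (subst (evalDNF Ts (flip (var l) x) ≤ᵇ_) Tsx
      (evalDNF-flip-≤ l x lx Ts (unate⇒negate∉ u l (here (here refl)) ∘ there)))
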